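{- Let $X$ be any set and let $A$ and $B$ be nonempty disjoint subsets of $X$. Then there exists a total order $\preceq$ on $X$ such that $$\forall x,y\in X\ \left[(x\in A \text{ and } y\in B)\implies x\preceq y\right].$$
   Context: A total order (linear order) on $X$ is a reflexive, antisymmetric, transitive relation $\preceq$ on $X$ in which any two elements are comparable. -}

module Defs where

{-# OPTIONS --safe #-}

-- Zermelo's 1908 argument.  Given a choice function c on the subsets of X, let
-- the tower be the least family of subsets closed under S ↦ S ∖ {c S} and under
-- intersections.  The tower is a chain, and x is the chosen point of the least
-- member R x of the tower containing x, so x ↦ R x is injective and reverse
-- inclusion of the R x totally orders X.  If c picks points outside B whenever
-- it can, then everything outside B comes before everything in B.
module Submission where

open import Defs
open import Level using (Level; 0ℓ)
open import Data.Bool using (Bool; true; false; T)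
open import Data.Product using (Σ-syntax; ∃; _×_; _,_; proj₁; proj₂)
open import Data.Sum using (_⊎_; inj₁; inj₂; swap)
open import Function using (id; _∘_)
open import Relation.Nullary using (¬_; yes; no; contradiction)
open import Relation.Nullary.Decidable using (⌊_⌋; toWitness; fromWitness)
open import Relation.Unary using (Pred; Satisfiable; _⊥_; _∈_)
open import Relation.Binary using (Rel; IsTotalOrder)
open import Relation.Binary.PropositionalEquality
  using (_≡_; _≢_; refl; sym; trans; cong; subst; isEquivalence)
open import Axiom.ExcludedMiddle using (ExcludedMiddle)
open import Axiom.Extensionality.Propositional using (Extensionality)

-- Subsets are Bool-valued so that Subset X, and families of subsets, stay in
-- the universe of X, where excluded middle is available.
Subset : ∀ {ℓ} → Set ℓ → Set ℓ
Subset X = X → Bool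

module _ {ℓ} {X : Set ℓ} where

  infix 4 _∈ₛ_ _⊆ₛ_

  _∈ₛ_ : X → Subset X → Set
  x ∈ₛ S = T (S x)

  _⊆ₛ_ : Subset X → Subset X → Set ℓ
  S ⊆ₛ U = ∀ x → x ∈ₛ S → x ∈ₛ U

T-antisym : ∀ {a b} → (T a → T b) → (T b → T a) → a ≡ b
T-antisym {true}  {true}  _ _ = refl
T-antisym {true}  {false} f _ = contradiction _ f
T-antisym {false} {true}  _ g = contradiction _ g
T-antisym {false} {false} _ _ = refl

module Comprehension {ℓ} (em : ExcludedMiddle ℓ) {Y : Set ℓ} where

  ⟦_⟧ : Pred Y ℓ → Subset Y
  ⟦ P ⟧ y = ⌊ em {P y} ⌋

  ∈⟦⟧⁺ : ∀ (P : Pred Y ℓ) {y} → P y → y ∈ₛ ⟦ P ⟧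
  ∈⟦⟧⁺ P {y} = fromWitness {a? = em {P y}}

  ∈⟦⟧⁻ : ∀ (P : Pred Y ℓ) {y} → y ∈ₛ ⟦ P ⟧ → P y
  ∈⟦⟧⁻ P {y} = toWitness {a? = em {P y}}

module Zermelo {ℓ} (em : ExcludedMiddle ℓ) (ext : Extensionality ℓ 0ℓ) {X : Set ℓ}
  (c : Subset X → X) (c∈ : ∀ S {x} → x ∈ₛ S → c S ∈ₛ S) where

  open Comprehension em

  ⊆ₛ-antisym : ∀ {S U : Subset X} → S ⊆ₛ U → U ⊆ₛ S → S ≡ U
  ⊆ₛ-antisym S⊆U U⊆S = ext λ x → T-antisym (S⊆U x) (U⊆S x)

  Remaining : Subset X → Pred X ℓ
  Remaining S x = x ∈ₛ S × x ≢ c S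

  remove : Subset X → Subset X
  remove S = ⟦ Remaining S ⟧

  InAll : Subset (Subset X) → Pred X ℓ
  InAll F x = ∀ S → S ∈ₛ F → x ∈ₛ S

  ⋂ : Subset (Subset X) → Subset X
  ⋂ F = ⟦ InAll F ⟧

  remove⊆ : ∀ {S} → remove S ⊆ₛ S
  remove⊆ {S} x = proj₁ ∘ ∈⟦⟧⁻ (Remaining S)

  ⋂⊆ : ∀ {F S} → S ∈ₛ F → ⋂ F ⊆ₛ S
  ⋂⊆ {F} {S} S∈F x x∈⋂ = ∈⟦⟧⁻ (InAll F) x∈⋂ S S∈F

  ⊆⋂ : ∀ {F U} → (∀ S → S ∈ₛ F → U ⊆ₛ S) → U ⊆ₛ ⋂ F
  ⊆⋂ {F} U⊆ x x∈U = ∈⟦⟧⁺ (InAll F) λ S S∈F → U⊆ S S∈F x x∈U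

  -- The whole of `X` enters as the intersection of the empty family, which starts the tower.
  data Tower : Pred (Subset X) ℓ where
    removeᵗ : ∀ {S} → Tower S → Tower (remove S)
    ⋂ᵗ      : ∀ {F} → (∀ S → S ∈ₛ F → Tower S) → Tower (⋂ F)

  -- If some member of `F` lies inside `V`, so does `⋂ F`; otherwise the first alternative holds
  -- throughout `F`. This is the intersection case of both inductions on `Tower`.
  ⋂-compare : ∀ F {U V} →
    (∀ S → S ∈ₛ F → U ⊆ₛ S ⊎ S ⊆ₛ V) → U ⊆ₛ ⋂ F ⊎ ⋂ F ⊆ₛ V
  ⋂-compare F {U} {V} cmp with em {∃ λ S → S ∈ₛ F × S ⊆ₛ V}
  ... | yes (S , S∈F , S⊆V) = inj₂ λ x → S⊆V x ∘ ⋂⊆ S∈F x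
  ... | no ∄S = inj₁ (⊆⋂ λ S S∈F → above S S∈F (cmp S S∈F))
    where
    above : ∀ S → S ∈ₛ F → U ⊆ₛ S ⊎ S ⊆ₛ V → U ⊆ₛ S
    above S S∈F (inj₁ U⊆S) = U⊆S
    above S S∈F (inj₂ S⊆V) = contradiction (S , S∈F , S⊆V) ∄S

  ⊆remove : ∀ {S U} → S ⊆ₛ U → ¬ (c U ∈ₛ S) → S ⊆ₛ remove U
  ⊆remove {S} {U} S⊆U cU∉S x x∈S =
    ∈⟦⟧⁺ (Remaining U) (S⊆U x x∈S , λ x≡cU → cU∉S (subst (_∈ₛ S) x≡cU x∈S))

  remove⊆⇒⊆ : ∀ {S U} → c U ∈ₛ S → remove U ⊆ₛ S → U ⊆ₛ S
  remove⊆⇒⊆ {S} {U} cU∈S rU⊆S x x∈U with em {x ≡ c U}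
  ... | yes x≡cU = subst (_∈ₛ S) (sym x≡cU) cU∈S
  ... | no  x≢cU = rU⊆S x (∈⟦⟧⁺ (Remaining U) (x∈U , x≢cU))

  Comparable : Pred (Subset X) ℓ
  Comparable S = ∀ {U} → Tower U → S ⊆ₛ U ⊎ U ⊆ₛ S

  -- Induction on `Tower U`: a removal deletes at most one point, so it cannot step past `S` without
  -- landing on it.
  comparable-gap : ∀ {S} → Comparable S → ∀ {U} → Tower U → S ⊆ₛ U ⊎ U ⊆ₛ remove S
  comparable-gap cmp (⋂ᵗ {F} t) = ⋂-compare F λ U U∈F → comparable-gap cmp (t U U∈F)
  comparable-gap {S} cmp (removeᵗ {U} t) with comparable-gap cmp t | cmp (removeᵗ t)
  ... | inj₂ U⊆rS | _          = inj₂ λ x → U⊆rS x ∘ remove⊆ x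
  ... | inj₁ _    | inj₁ S⊆rU  = inj₁ S⊆rU
  -- `S` is squeezed between `remove U` and `U`, which differ at most in `c U`. If `c U` is in `S`,
  -- then `S` is `U`; if not, `S` survives the removal.
  ... | inj₁ S⊆U  | inj₂ rU⊆S with S (c U) in eq
  ...   | true  = inj₂ (subst (λ V → remove U ⊆ₛ remove V) U≡S λ _ → id)
    where
    U≡S : U ≡ S
    U≡S = ⊆ₛ-antisym (remove⊆⇒⊆ (subst T (sym eq) _) rU⊆S) S⊆U
  ...   | false = inj₁ (⊆remove S⊆U (subst T eq))

  tower-comparable : ∀ {S} → Tower S → Comparable S
  tower-comparable (removeᵗ s) t with comparable-gap (tower-comparable s) t
  ... | inj₁ S⊆U  = inj₁ λ x → S⊆U x ∘ remove⊆ x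
  ... | inj₂ U⊆rS = inj₂ U⊆rS
  tower-comparable (⋂ᵗ {F} s) t =
    swap (⋂-compare F λ S S∈F → swap (tower-comparable (s S S∈F) t))

  Around : X → Pred (Subset X) ℓ
  Around x S = Tower S × x ∈ₛ S

  R : X → Subset X
  R x = ⋂ ⟦ Around x ⟧

  R-tower : ∀ x → Tower (R x)
  R-tower x = ⋂ᵗ λ S → proj₁ ∘ ∈⟦⟧⁻ (Around x)

  x∈R : ∀ x → x ∈ₛ R x
  x∈R x = ∈⟦⟧⁺ (InAll ⟦ Around x ⟧) λ S → proj₂ ∘ ∈⟦⟧⁻ (Around x)

  R-least : ∀ {x S} → Tower S → x ∈ₛ S → R x ⊆ₛ S
  R-least {x} t x∈S = ⋂⊆ (∈⟦⟧⁺ (Around x) (t , x∈S))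

  -- Otherwise `remove (R x)` would be a tower member still containing `x`, so by minimality it
  -- would contain `R x` and with it the very point removed. Thus `c` is a left inverse of `R`,
  -- which yields antisymmetry.
  cR≡ : ∀ x → c (R x) ≡ x
  cR≡ x with em {x ≡ c (R x)}
  ... | yes x≡c = sym x≡c
  ... | no  x≢c = contradiction refl (proj₂ (∈⟦⟧⁻ (Remaining (R x)) c∈remove))
    where
    c∈remove : c (R x) ∈ₛ remove (R x)
    c∈remove = R-least (removeᵗ (R-tower x)) (∈⟦⟧⁺ (Remaining (R x)) (x∈R x , x≢c))
      (c (R x)) (c∈ (R x) (x∈R x))

  _≼_ : Rel X ℓ
  x ≼ y = R y ⊆ₛ R x

  ≼-isTotalOrder : IsTotalOrder _≡_ _≼_
  ≼-isTotalOrder = record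
    { isPartialOrder = record
      { isPreorder = record
        { isEquivalence = isEquivalence
        ; reflexive     = λ { refl _ → id }
        ; trans         = λ x≼y y≼z w → x≼y w ∘ y≼z w
        }
      ; antisym = λ {x} {y} x≼y y≼x →
          trans (sym (cR≡ x)) (trans (cong c (⊆ₛ-antisym y≼x x≼y)) (cR≡ y))
      }
    ; total = λ x y → swap (tower-comparable (R-tower x) (R-tower y))
    }

module _ {ℓ} (em : ExcludedMiddle ℓ) {X : Set ℓ} (B : Pred X ℓ) where

  -- Points outside `B` are tried first, then any point of `S`. The default `x₀` is returned only
  -- for empty `S`, where both conditions are vacuous.
  choose-avoiding : X → (S : Subset X) → Σ[ z ∈ X ]
    ((∀ {x} → x ∈ₛ S → z ∈ₛ S) × (∀ {x} → x ∈ₛ S → ¬ B x → ¬ B z))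
  choose-avoiding x₀ S with em {∃ λ x → x ∈ₛ S × ¬ B x} | em {∃ λ x → x ∈ₛ S}
  ... | yes (z , z∈S , z∉B) | _             = z , (λ _ → z∈S) , λ _ _ → z∉B
  ... | no ∄x               | yes (z , z∈S) =
    z , (λ _ → z∈S) , λ x∈S x∉B → contradiction (_ , x∈S , x∉B) ∄x
  ... | no ∄x               | no ∄z         =
    x₀ , (λ x∈S → contradiction (_ , x∈S) ∄z) , λ x∈S _ → contradiction (_ , x∈S) ∄z

proposition6 : ∀ {ℓ : Level} → ExcludedMiddle ℓ → Extensionality ℓ 0ℓ →
    (X : Set ℓ) (A B : Pred X ℓ) →
    Satisfiable A → Satisfiable B → A ⊥ B →
    Σ[ _≼_ ∈ Rel X ℓ ] (IsTotalOrder _≡_ _≼_ × (∀ x y → (x ∈ A × y ∈ B) → x ≼ y))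
proposition6 em ext X A B (x₀ , _) _ A⊥B = _≼_ , ≼-isTotalOrder , A≼B
  where
  choose : (S : Subset X) → _
  choose = choose-avoiding em B x₀

  open Zermelo em ext (proj₁ ∘ choose) (λ S → proj₁ (proj₂ (choose S)))

  A≼B : ∀ x y → x ∈ A × y ∈ B → x ≼ y
  A≼B x y (x∈A , y∈B) with IsTotalOrder.total ≼-isTotalOrder x y
  ... | inj₁ x≼y = x≼y
  -- Here `x` lies in `R y` and outside `B`, so the choice from `R y` avoids `B`; but that choice is
  -- `y`.
  ... | inj₂ y≼x = contradiction (subst B (sym (cR≡ y)) y∈B)
    (proj₂ (proj₂ (choose (R y))) (y≼x x (x∈R x)) λ x∈B → A⊥B (x∈A , x∈B))
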